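{- Let $\mathcal B$ be an IPC-DDSA and $\chi$ an IPC property. Then the verification problem for $\mathcal B$ and $\chi$ is solvable: one can effectively compute a configuration map $K\colon B\to\mathcal C(V)$ such that for every control state $b\in B$ and every assignment $\alpha$, $(b,\alpha)\models\chi$ if and only if $\alpha\models K(b)$. In particular, $(b_I,\alpha_I)\models\chi$ is decidable.
   Context: Integer periodicity constraints (IPCs) over integer-valued variables are atoms of the forms $x=y$, $x\odot d$ with $\odot\in\{=,\neq,<,>\}$, $x\equiv_k y+d$, and $x\equiv_k d$, where $x,y$ are variables with domain $\mathbb Z$, $k,d\in\mathbb N$, and $\equiv_k$ is congruence modulo $k$. An IPC-DDSA is a DDSA all of whose variables are integer-valued and whose guards are conjunctions of IPCs; an IPC property is a $\mathrm{CTL}^*_f$ state formula whose constraint atoms are IPCs. A DDSA is $\mathcal B=\langle B,b_I,\mathcal A,T,B_F,V,\alpha_I,\mathit{guard}\rangle$ with finite control states $B$, initial state $b_I$, actions $\mathcal A$, $T\subseteq B\times\mathcal A\times B$, final states $B_F$, initial assignment $\alpha_I$, and $\mathit{guard}$ assigning to each action a quantifier-free constraint over read copies $v^r$ and write copies $v^w$ of the variables $v\in V$; $\mathit{write}(a)=\{v\mid v^w\text{ occurs in }\mathit{guard}(a)\}$. A step $(b,\alpha)\xrightarrow{a}(b',\alpha')$ requires $(b,a,b')\in T$, $\alpha'(v)=\alpha(v)$ for $v\notin\mathit{write}(a)$, and $\beta\models\mathit{guard}(a)$ for $\beta(v^r)=\alpha(v),\beta(v^w)=\alpha'(v)$. Runs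 are finite sequences of steps; $\mathrm{FRuns}(b,\alpha)$ is the set of runs from $(b,\alpha)$ ending in a state of $B_F$. $\mathrm{CTL}^*_f$: state formulas $\chi::=\top\mid c\mid b\mid\chi\wedge\chi\mid\neg\chi\mid\mathsf E\psi$ (constraints $c$ over $V$, $b\in B$), path formulas $\psi::=\chi\mid\psi\wedge\psi\mid\neg\psi\mid\mathsf X\psi\mid\mathsf G\psi\mid\psi\,\mathsf U\,\psi$; $(b,\alpha)\models c$ iff $\alpha\models c$; $(b,\alpha)\models b'$ iff $b=b'$; $(b,\alpha)\models\mathsf E\psi$ iff some $\rho\in\mathrm{FRuns}(b,\alpha)$ satisfies $\psi$ at position 0; on a run of length $n$ with configurations $\rho_0,\dots,\rho_n$: a state formula holds at $i$ iff it holds at $\rho_i$; $\mathsf X\psi$ holds at $i$ iff $i<n$ and $\psi$ holds at $i+1$; $\mathsf G\psi$ iff $\psi$ holds at all $j$ with $i\le j\le n$; $\psi\,\mathsf U\,\psi'$ iff $\psi'$ holds at some $i+k\le n$ and $\psi$ holds at $i+j$ for all $0\le j<k$. A configuration map is a function $K$ from control states to quantifier-free constraints over $V$.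
   Formalization: The moduli k in the congruence constraints are taken to be positive; with k = 0 congruence is equality, so counters could be incremented and decremented exactly and the claim would be false. -}

module Defs where

open import Data.Nat using (ℕ; suc; NonZero)
open import Data.Integer as ℤ using (ℤ; +_)
open import Data.Integer.Divisibility using (_∣_)
open import Data.Fin using (Fin; zero; suc; toℕ; _≤_; _<_)
open import Data.Fin.Subset using (Subset) renaming (_∈_ to _∈ₛ_)
open import Data.List using (List; []; _∷_; concatMap)
open import Data.List.Membership.Propositional using (_∈_)
open import Data.List.Relation.Unary.All using (All)
open import Data.Product using (_×_; _,_; ∃-syntax; proj₁)
open import Data.Unit using (⊤)
open import Relation.Binary.PropositionalEquality using (_≡_; _≢_)
open import Relation.Binary.Construct.Closure.ReflexiveTransitive using (Star; ε; _◅_)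
open import Relation.Nullary using (¬_)

Assignment : Set → Set
Assignment V = V → ℤ

data Comparison : Set where
  eq neq lt gt : Comparison

-- Moduli are positive: congruence modulo 0 would be equality, so that
-- x ≡₀ y + 1 would be a counter increment and model checking undecidable.
data IPC (V : Set) : Set where
  _≐_       : V → V → IPC V
  _⟨_⟩_     : V → Comparison → ℕ → IPC V
  _≡[_]_⊕_  : V → (k : ℕ) → .{{_ : NonZero k}} → V → ℕ → IPC V
  _≡[_]_    : V → (k : ℕ) → .{{_ : NonZero k}} → ℕ → IPC V

compare : Comparison → ℤ → ℤ → Set
compare eq  m n = m ≡ n
compare neq m n = m ≢ n
compare lt  m n = m ℤ.< n
compare gt  m n = m ℤ.> n

_≡_mod_ : ℤ → ℤ → ℕ → Set
m ≡ n mod k = (+ k) ∣ (m ℤ.- n)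

infix 4 _⊨ᵃ_ _⊨ᶜ_

_⊨ᵃ_ : {V : Set} → Assignment V → IPC V → Set
α ⊨ᵃ (x ≐ y)          = α x ≡ α y
α ⊨ᵃ (x ⟨ ⊙ ⟩ d)      = compare ⊙ (α x) (+ d)
α ⊨ᵃ (x ≡[ k ] y ⊕ d) = α x ≡ (α y ℤ.+ + d) mod k
α ⊨ᵃ (x ≡[ k ] d)     = α x ≡ (+ d) mod k

vars : {V : Set} → IPC V → List V
vars (x ≐ y)          = x ∷ y ∷ []
vars (x ⟨ _ ⟩ _)      = x ∷ []
vars (x ≡[ _ ] y ⊕ _) = x ∷ y ∷ []
vars (x ≡[ _ ] _)     = x ∷ []

data Constraint (V : Set) : Set where
  trueᶜ : Constraint V
  atom  : IPC V → Constraint V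
  _∧ᶜ_  : Constraint V → Constraint V → Constraint V
  ¬ᶜ_   : Constraint V → Constraint V

_⊨ᶜ_ : {V : Set} → Assignment V → Constraint V → Set
α ⊨ᶜ trueᶜ    = ⊤
α ⊨ᶜ atom c   = α ⊨ᵃ c
α ⊨ᶜ (c ∧ᶜ d) = (α ⊨ᶜ c) × (α ⊨ᶜ d)
α ⊨ᶜ (¬ᶜ c)   = ¬ (α ⊨ᶜ c)

data Copy (V : Set) : Set where
  _ʳ _ʷ : V → Copy V

record IPC-DDSA : Set where
  field
    #states #actions #vars : ℕ

  State  = Fin #states
  Action = Fin #actions
  Var    = Fin #vars

  field
    b-I   : State
    T     : List (State × Action × State)
    B-F   : Subset #states
    α-I   : Assignment Var
    -- a list of atoms is read as their conjunction
    guard : Action → List (IPC (Copy Var))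

  write : Action → Var → Set
  write a v = (v ʷ) ∈ concatMap vars (guard a)

  Config : Set
  Config = State × Assignment Var

  readWrite : Assignment Var → Assignment Var → Assignment (Copy Var)
  readWrite α α′ (v ʳ) = α v
  readWrite α α′ (v ʷ) = α′ v

  record Step (a : Action) (b : State) (α : Assignment Var)
              (b′ : State) (α′ : Assignment Var) : Set where
    field
      transition : (b , a , b′) ∈ T
      inertia    : ∀ v → ¬ write a v → α′ v ≡ α v
      guarded    : All (readWrite α α′ ⊨ᵃ_) (guard a)

  _⟶_ : Config → Config → Set
  (b , α) ⟶ (b′ , α′) = ∃[ a ] Step a b α b′ α′

  Run : Config → Config → Set
  Run = Star _⟶_

  length : ∀ {c c′} → Run c c′ → ℕ
  length ε       = 0
  length (_ ◅ ρ) = suc (length ρ)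

  Position : ∀ {c c′} → Run c c′ → Set
  Position ρ = Fin (suc (length ρ))

  _at_ : ∀ {c c′} (ρ : Run c c′) → Position ρ → Config
  _at_ {c} ρ       zero    = c
  _at_     (_ ◅ ρ) (suc i) = ρ at i

  record FRuns (c : Config) : Set where
    field
      {end}   : Config
      run     : Run c end
      isFinal : proj₁ end ∈ₛ B-F

mutual
  data StateFormula (B V : Set) : Set where
    trueˢ      : StateFormula B V
    constraint : IPC V → StateFormula B V
    control    : B → StateFormula B V
    _∧ˢ_       : StateFormula B V → StateFormula B V → StateFormula B V
    ¬ˢ_        : StateFormula B V → StateFormula B V
    E_         : PathFormula B V → StateFormula B V

  data PathFormula (B V : Set) : Set where
    state : StateFormula B V → PathFormula B V
    _∧ᵖ_  : PathFormula B V → PathFormula B V → PathFormula B V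
    ¬ᵖ_   : PathFormula B V → PathFormula B V
    X_ G_ : PathFormula B V → PathFormula B V
    _U_   : PathFormula B V → PathFormula B V → PathFormula B V

module Semantics (𝓑 : IPC-DDSA) where
  open IPC-DDSA 𝓑

  IPCProperty : Set
  IPCProperty = StateFormula State Var

  ConfigurationMap : Set
  ConfigurationMap = State → Constraint Var

  infix 4 _⊨_ _,_⊨ᵖ_

  mutual
    _⊨_ : Config → StateFormula State Var → Set
    c       ⊨ trueˢ        = ⊤
    (b , α) ⊨ constraint φ = α ⊨ᵃ φ
    (b , α) ⊨ control b′   = b ≡ b′
    c       ⊨ (χ ∧ˢ χ′)    = (c ⊨ χ) × (c ⊨ χ′)
    c       ⊨ (¬ˢ χ)       = ¬ (c ⊨ χ)
    c       ⊨ (E ψ)        = ∃[ ρ ] FRuns.run {c} ρ , zero ⊨ᵖ ψ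

    _,_⊨ᵖ_ : ∀ {c c′} (ρ : Run c c′) → Position ρ → PathFormula State Var → Set
    ρ , i ⊨ᵖ state χ   = (ρ at i) ⊨ χ
    ρ , i ⊨ᵖ (ψ ∧ᵖ ψ′) = (ρ , i ⊨ᵖ ψ) × (ρ , i ⊨ᵖ ψ′)
    ρ , i ⊨ᵖ (¬ᵖ ψ)    = ¬ (ρ , i ⊨ᵖ ψ)
    ρ , i ⊨ᵖ (X ψ)     = ∃[ j ] (toℕ j ≡ suc (toℕ i)) × (ρ , j ⊨ᵖ ψ)
    ρ , i ⊨ᵖ (G ψ)     = ∀ j → i ≤ j → ρ , j ⊨ᵖ ψ
    ρ , i ⊨ᵖ (ψ U ψ′)  =
      ∃[ m ] (i ≤ m) × (ρ , m ⊨ᵖ ψ′) × (∀ j → i ≤ j → j < m → ρ , j ⊨ᵖ ψ)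

{-# OPTIONS --safe #-}

-- Choose N such that every constant occurring in the system or in the formula is below N and every
-- modulus divides N. Call two assignments equivalent if they agree on comparisons with the constants
-- below N, on residues modulo N, and on which variables are equal. A written value can be
-- answered in an equivalent assignment: by the partner of an equal value if there is one, by itself
-- if it lies in [0, N), and otherwise by an unused element of its residue class on the same side of
-- [0, N). So equivalence is a bisimulation, and since the unused element can be taken of bounded
-- size, every configuration is bisimilar to one in a fixed finite box and steps can be answered
-- inside the box. There E ψ is decided by reachability in the product of the box with a
-- deterministic automaton that reads runs backwards. Equivalence to a given assignment is expressible
-- by a constraint, and K(b) is the disjunction of these over the box assignments satisfying χ at b.
module Submission where

open import Defs
open import Algebra.Properties.AbelianGroup using (∙-cancelˡ)
open import Data.Bool as Bool using (Bool; true; false; not; T; _∧_; _∨_)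
open import Data.Bool.Properties using (T-∧; T-∨; T?)
open import Data.Empty using (⊥)
open import Data.Fin as Fin using (Fin; zero; suc; _↑ˡ_; _↑ʳ_; splitAt; finToFun; funToFin)
import Data.Fin.Properties as Fin
open import Data.Fin.Subset using () renaming (_∈_ to _∈ₛ_)
import Data.Fin.Subset.Properties as Subset
open import Data.Integer as ℤ using (ℤ; +_; -[1+_]; +≤+; +<+; -<+; ∣_∣)
open import Data.Integer.DivMod using (_%ℕ_; _/ℕ_; n%ℕd<d; a≡a%ℕn+[a/ℕn]*n)
import Data.Integer.Divisibility.Signed as Signed
import Data.Integer.Properties as ℤ
open import Data.Integer.Tactic.RingSolver using (solve-∀)
open import Data.List as List using (List; []; _∷_; allFin; cartesianProduct; concatMap; length; map; tabulate)
import Data.List.Membership.DecPropositional as DecMembership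
open import Data.List.Membership.Propositional using (_∈_; _∉_; find; lose)
open import Data.List.Membership.Propositional.Properties
  using (∈-allFin; ∈-cartesianProduct⁺; ∈-map⁺; ∈-map⁻; ∈-tabulate⁺; ∈-tabulate⁻)
open import Data.List.Properties using (length-map; length-tabulate)
open import Data.List.Relation.Unary.All as All using (All; []; _∷_)
import Data.List.Relation.Unary.All.Properties as All
open import Data.List.Relation.Unary.Any using (here; there; any?; index)
open import Data.List.Relation.Unary.Any.Properties using (lookup-index)
open import Data.Maybe as Maybe using (Maybe; just; nothing; maybe′)
open import Data.Nat as ℕ using (ℕ; zero; suc; NonZero)
import Data.Nat.Divisibility as ℕ
open import Data.Nat.ListAction using (product)
open import Data.Nat.ListAction.Properties using (∈⇒∣product; product≢0)
import Data.Nat.Properties as ℕ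
open import Data.Product using (_×_; _,_; Σ; ∃; ∃-syntax; proj₁; proj₂)
open import Data.Product.Function.NonDependent.Propositional using (_×-⇔_)
open import Data.Product.Properties using (≡-dec)
open import Data.Sum using (_⊎_; inj₁; inj₂)
open import Data.Sum.Function.Propositional using (_⊎-⇔_)
open import Data.Unit using (⊤)
open import Function using (_∘_; id; const)
open import Function.Bundles using (_⇔_; mk⇔; module Equivalence)
open import Function.Construct.Composition using () renaming (_⇔-∘_ to infixr 8 _∘⇔_)
open import Function.Construct.Identity using (⇔-id)
open import Function.Construct.Symmetry using (⇔-sym)
open import Function.Related.TypeIsomorphisms using (→-cong-⇔; ¬-cong-⇔)
open import Relation.Binary using (Decidable; DecidableEquality)
open import Relation.Binary.Construct.Closure.ReflexiveTransitive using (Star; ε; _◅_; _◅◅_)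
open import Relation.Binary.PropositionalEquality using (_≡_; refl; sym; trans; cong; cong₂; subst; subst₂)
open import Relation.Nullary using (¬_; Dec; yes; no; contradiction)
open import Relation.Nullary.Decidable
  using (map′; _×-dec_; _⊎-dec_; _→-dec_; ¬?; ⌊_⌋; isYes≗does; does-⇔; decidable-stable; toWitness; fromWitness)
open DecMembership ℤ._≟_ using (_∈?_)
open Equivalence using (to; from)

-- Finite types and search through them

record Finite (A : Set) : Set where
  field
    elements : List A
    complete : ∀ a → a ∈ elements
    _≟_      : DecidableEquality A

  ∃? : {P : A → Set} → (∀ a → Dec (P a)) → Dec (∃ P)
  ∃? P? = map′ (λ p → let a , _ , pa = find p in a , pa) (λ (a , pa) → lose (complete a) pa)
               (any? P? elements)

open Finite using (∃?)

Bool-finite : Finite Bool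
Bool-finite = record
  { elements = true ∷ false ∷ []
  ; complete = λ { true → here refl ; false → there (here refl) }
  ; _≟_      = Bool._≟_
  }

Fin-finite : ∀ n → Finite (Fin n)
Fin-finite n = record { elements = allFin n ; complete = ∈-allFin ; _≟_ = Fin._≟_ }

infixr 2 _×-finite_

_×-finite_ : ∀ {A B} → Finite A → Finite B → Finite (A × B)
A ×-finite B = record
  { elements = cartesianProduct (Finite.elements A) (Finite.elements B)
  ; complete = λ (a , b) → ∈-cartesianProduct⁺ (Finite.complete A a) (Finite.complete B b)
  ; _≟_      = ≡-dec (Finite._≟_ A) (Finite._≟_ B)
  }

-- Warshall's algorithm: Via xs relates the endpoints of walks whose inner nodes all lie in xs.
module Reachability {A : Set} {R : A → A → Set} where

  Via : List A → A → A → Set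
  Via []       a b = a ≡ b ⊎ R a b
  Via (x ∷ xs) a b = Via xs a b ⊎ (Via xs a x × Via xs x b)

  Via? : DecidableEquality A → Decidable R → ∀ xs → Decidable (Via xs)
  Via? _≟_ R? []       a b = (a ≟ b) ⊎-dec R? a b
  Via? _≟_ R? (x ∷ xs) a b = Via? _≟_ R? xs a b ⊎-dec (Via? _≟_ R? xs a x ×-dec Via? _≟_ R? xs x b)

  Via⇒Star : ∀ xs {a b} → Via xs a b → Star R a b
  Via⇒Star []       (inj₁ refl)    = ε
  Via⇒Star []       (inj₂ r)       = r ◅ ε
  Via⇒Star (x ∷ xs) (inj₁ p)       = Via⇒Star xs p
  Via⇒Star (x ∷ xs) (inj₂ (p , q)) = Via⇒Star xs p ◅◅ Via⇒Star xs q

  Via-weaken : ∀ xs {a b} → Via [] a b → Via xs a b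
  Via-weaken []       p = p
  Via-weaken (x ∷ xs) p = inj₁ (Via-weaken xs p)

  Via-to-head : ∀ {x xs a} → Via (x ∷ xs) a x → Via xs a x
  Via-to-head (inj₁ p)       = p
  Via-to-head (inj₂ (p , _)) = p

  Via-from-head : ∀ {x xs b} → Via (x ∷ xs) x b → Via xs x b
  Via-from-head (inj₁ p)       = p
  Via-from-head (inj₂ (_ , p)) = p

  -- If both walks pass through the head `x`, the loop from `x` over `y` back to `x` is cut out; if
  -- `y` itself is the head, each walk is cut at it. Otherwise the pieces that meet at `y` avoid `x`
  -- and are joined by induction.
  Via-trans : ∀ {xs a y b} → y ∈ xs → Via xs a y → Via xs y b → Via xs a b
  Via-trans {x ∷ xs} (here refl)  p              q              =
    inj₂ (Via-to-head {xs = xs} p , Via-from-head {xs = xs} q)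
  Via-trans {x ∷ xs} (there y∈xs) (inj₁ p)       (inj₁ q)       = inj₁ (Via-trans y∈xs p q)
  Via-trans {x ∷ xs} (there y∈xs) (inj₁ p)       (inj₂ (q , r)) = inj₂ (Via-trans y∈xs p q , r)
  Via-trans {x ∷ xs} (there y∈xs) (inj₂ (p , q)) (inj₁ r)       = inj₂ (p , Via-trans y∈xs q r)
  Via-trans {x ∷ xs} (there y∈xs) (inj₂ (p , _)) (inj₂ (_ , q)) = inj₂ (p , q)

  Star⇒Via : ∀ {xs} → (∀ x → x ∈ xs) → ∀ {a b} → Star R a b → Via xs a b
  Star⇒Via complete ε       = Via-weaken _ (inj₁ refl)
  Star⇒Via complete (r ◅ s) = Via-trans (complete _) (Via-weaken _ (inj₂ r)) (Star⇒Via complete s)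

  Star? : Finite A → Decidable R → Decidable (Star R)
  Star? A-finite R? a b = map′ (Via⇒Star elements) (Star⇒Via complete) (Via? _≟_ R? elements a b)
    where open Finite A-finite

-- Definability by constraints

_≡_mod?_ : ∀ m n k → Dec (m ≡ n mod k)
m ≡ n mod? k = k ℕ.∣? ∣ m ℤ.- n ∣

compare? : ∀ ⊙ m n → Dec (compare ⊙ m n)
compare? eq  m n = m ℤ.≟ n
compare? neq m n = ¬? (m ℤ.≟ n)
compare? lt  m n = m ℤ.<? n
compare? gt  m n = n ℤ.<? m

_⊨ᵃ?_ : {V : Set} (α : Assignment V) (c : IPC V) → Dec (α ⊨ᵃ c)
α ⊨ᵃ? (x ≐ y)          = α x ℤ.≟ α y
α ⊨ᵃ? (x ⟨ ⊙ ⟩ d)      = compare? ⊙ (α x) (+ d)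
α ⊨ᵃ? (x ≡[ k ] y ⊕ d) = α x ≡ (α y ℤ.+ + d) mod? k
α ⊨ᵃ? (x ≡[ k ] d)     = α x ≡ (+ d) mod? k

_⊨ᶜ?_ : {V : Set} (α : Assignment V) (c : Constraint V) → Dec (α ⊨ᶜ c)
α ⊨ᶜ? trueᶜ    = yes _
α ⊨ᶜ? atom c   = α ⊨ᵃ? c
α ⊨ᶜ? (c ∧ᶜ d) = (α ⊨ᶜ? c) ×-dec (α ⊨ᶜ? d)
α ⊨ᶜ? (¬ᶜ c)   = ¬? (α ⊨ᶜ? c)

Definable : {V : Set} → (Assignment V → Set) → Set
Definable P = ∃[ c ] ∀ α → P α ⇔ (α ⊨ᶜ c)

module _ {V : Set} where

  definable-⇔ : {P Q : Assignment V → Set} → (∀ α → P α ⇔ Q α) → Definable P → Definable Q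
  definable-⇔ P⇔Q (c , P⇔c) = c , λ α → P⇔c α ∘⇔ ⇔-sym (P⇔Q α)

  definable-atom : (c : IPC V) → Definable (_⊨ᵃ c)
  definable-atom c = atom c , λ α → ⇔-id _

  definable-dec : {A : Set} → Dec A → Definable {V} (const A)
  definable-dec (yes a) = trueᶜ , λ α → mk⇔ _ (const a)
  definable-dec (no ¬a) = ¬ᶜ trueᶜ , λ α → mk⇔ (λ a _ → ¬a a) (λ f → contradiction _ f)

  definable-× : {P Q : Assignment V → Set} → Definable P → Definable Q → Definable (λ α → P α × Q α)
  definable-× (c , P⇔c) (d , Q⇔d) = c ∧ᶜ d , λ α → P⇔c α ×-⇔ Q⇔d α

  -- Constraints have only conjunction and negation, so the implication is expressed classically;
  -- this is sound because satisfaction of a constraint is decidable.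
  definable-→ : {P Q : Assignment V → Set} → Definable P → Definable Q → Definable (λ α → P α → Q α)
  definable-→ (c , P⇔c) (d , Q⇔d) = ¬ᶜ (c ∧ᶜ (¬ᶜ d)) , λ α →
    mk⇔ (λ f (p , ¬q) → ¬q (f p)) (λ f p → decidable-stable (α ⊨ᶜ? d) (λ ¬q → f (p , ¬q)))
    ∘⇔ →-cong-⇔ (P⇔c α) (Q⇔d α)

  definable-¬ : {P : Assignment V → Set} → Definable P → Definable (¬_ ∘ P)
  definable-¬ (c , P⇔c) = ¬ᶜ c , λ α → ¬-cong-⇔ (P⇔c α)

  definable-equiv : {P Q : Assignment V → Set} → Definable P → Definable Q → Definable (λ α → P α ⇔ Q α)
  definable-equiv P Q = definable-⇔ (λ α → mk⇔ (λ (f , g) → mk⇔ f g) (λ e → to e , from e))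
    (definable-× (definable-→ P Q) (definable-→ Q P))

  definable-∀ : ∀ {n} {P : Fin n → Assignment V → Set} →
                (∀ i → Definable (P i)) → Definable (λ α → ∀ i → P i α)
  definable-∀ {zero}  P = trueᶜ , λ α → mk⇔ _ (λ _ ())
  definable-∀ {suc n} P = definable-⇔
    (λ α → mk⇔ (λ { (p , ps) zero → p ; (p , ps) (suc i) → ps i }) (λ f → f zero , f ∘ suc))
    (definable-× (P zero) (definable-∀ (P ∘ suc)))

  definable-∀⊙ : {P : Comparison → Assignment V → Set} →
                 (∀ ⊙ → Definable (P ⊙)) → Definable (λ α → ∀ ⊙ → P ⊙ α)
  definable-∀⊙ P = definable-⇔
    (λ α → mk⇔ (λ { (p , _) eq → p ; (_ , p , _) neq → p ; (_ , _ , p , _) lt → p ; (_ , _ , _ , p) gt → p })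
               (λ f → f eq , f neq , f lt , f gt))
    (definable-× (P eq) (definable-× (P neq) (definable-× (P lt) (P gt))))

  -- Dual to `definable-∀`: a definable predicate is decidable at each assignment, and over a finite
  -- index set this removes the double negation.
  definable-∃ : ∀ {n} {P : Fin n → Assignment V → Set} →
                (∀ i → Definable (P i)) → Definable (λ α → ∃[ i ] P i α)
  definable-∃ {P = P} D = definable-⇔ (λ α → mk⇔ (¬∀¬⇒∃ α) (λ (i , p) f → f i p))
    (definable-¬ (definable-∀ (definable-¬ ∘ D)))
    where
    P? : ∀ α i → Dec (P i α)
    P? α i = map′ (from (proj₂ (D i) α)) (to (proj₂ (D i) α)) (α ⊨ᶜ? proj₁ (D i))
    ¬∀¬⇒∃ : ∀ α → ¬ (∀ i → ¬ P i α) → ∃[ i ] P i α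
    ¬∀¬⇒∃ α ¬∀¬ = decidable-stable (Fin.any? (P? α)) (λ ¬∃ → ¬∀¬ (λ i p → ¬∃ (i , p)))

-- Comparisons, congruences and fresh integers

compare-below : ∀ ⊙ {y z m} → y ℤ.< m → z ℤ.< m → compare ⊙ y m → compare ⊙ z m
compare-below eq  y<m z<m y≡m = contradiction y≡m (ℤ.<⇒≢ y<m)
compare-below neq y<m z<m _   = ℤ.<⇒≢ z<m
compare-below lt  y<m z<m _   = z<m
compare-below gt  y<m z<m y>m = contradiction y>m (ℤ.<-asym y<m)

compare-above : ∀ ⊙ {y z m} → y ℤ.> m → z ℤ.> m → compare ⊙ y m → compare ⊙ z m
compare-above eq  y>m z>m y≡m = contradiction (sym y≡m) (ℤ.<⇒≢ y>m)
compare-above neq y>m z>m _   = ℤ.<⇒≢ z>m ∘ sym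
compare-above gt  y>m z>m _   = z>m
compare-above lt  y>m z>m y<m = contradiction y<m (ℤ.<-asym y>m)

mod-sym : ∀ {k} m n → m ≡ n mod k → n ≡ m mod k
mod-sym {k} m n = subst (k ℕ.∣_) (ℤ.∣i-j∣≡∣j-i∣ m n)

mod-trans : ∀ {k} l m n → l ≡ m mod k → m ≡ n mod k → l ≡ n mod k
mod-trans {k} l m n p q = Signed.∣⇒∣ᵤ (subst (+ k Signed.∣_) (telescope l m n)
  (Signed.∣m∣n⇒∣m+n (Signed.∣ᵤ⇒∣ {+ k} {l ℤ.- m} p) (Signed.∣ᵤ⇒∣ {+ k} {m ℤ.- n} q)))
  where
  telescope : ∀ l m n → (l ℤ.- m) ℤ.+ (m ℤ.- n) ≡ l ℤ.- n
  telescope = solve-∀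

mod-+ʳ : ∀ {k} m n d → m ≡ n mod k → (m ℤ.+ d) ≡ (n ℤ.+ d) mod k
mod-+ʳ {k} m n d = subst (λ x → k ℕ.∣ ∣ x ∣) (eqn m n d)
  where
  eqn : ∀ m n d → m ℤ.- n ≡ (m ℤ.+ d) ℤ.- (n ℤ.+ d)
  eqn = solve-∀

-- Pigeonhole: were f 0, ..., f (length zs) all in `zs`, two of them would share an index and so be
-- equal. The bound on `j` later bounds the size of fresh values.
injective⇒fresh : (f : ℕ → ℤ) → (∀ {i j} → f i ≡ f j → i ≡ j) →
                  ∀ zs → ∃[ j ] (j ℕ.≤ length zs) × (f j ∉ zs)
injective⇒fresh f f-injective zs with Fin.any? {n = suc (length zs)} (λ j → ¬? (f (Fin.toℕ j) ∈? zs))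
... | yes (j , fj∉zs) = Fin.toℕ j , ℕ.s≤s⁻¹ (Fin.toℕ<n j) , fj∉zs
... | no ¬fresh =
  let i , j , i<j , same-index = Fin.pigeonhole (ℕ.n<1+n (length zs)) (index ∘ occurs)
      fi≡fj = trans (lookup-index (occurs i))
                (trans (cong (List.lookup zs) same-index) (sym (lookup-index (occurs j))))
  in contradiction (Fin.toℕ-injective (f-injective fi≡fj)) (Fin.<⇒≢ i<j)
  where
  occurs : ∀ j → f (Fin.toℕ j) ∈ zs
  occurs j = decidable-stable (_ ∈? zs) (λ fj∉zs → ¬fresh (j , fj∉zs))

-- A common multiple N ≢ 0 of all sizes exceeds every constant and is divisible by every modulus.
size : {V : Set} → IPC V → ℕ
size (x ≐ y)          = 1
size (x ⟨ _ ⟩ d)      = suc d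
size (x ≡[ k ] y ⊕ _) = k
size (x ≡[ k ] _)     = k

size≢0 : ∀ {V} (c : IPC V) → NonZero (size c)
size≢0 (x ≐ y)              = _
size≢0 (x ⟨ ⊙ ⟩ d)          = _
size≢0 (x ≡[ suc k ] y ⊕ d) = _
size≢0 (x ≡[ suc k ] d)     = _
size≢0 (x ≡[ zero ] y ⊕ d)  = contradiction refl (ℕ.≢-nonZero⁻¹ 0)
size≢0 (x ≡[ zero ] d)      = contradiction refl (ℕ.≢-nonZero⁻¹ 0)

mutual
  -- A product serves as the common multiple, because its dividing `N` passes to every factor.
  sizeˢ : ∀ {B V} → StateFormula B V → ℕ
  sizeˢ trueˢ          = 1
  sizeˢ (constraint c) = size c
  sizeˢ (control _)    = 1
  sizeˢ (χ ∧ˢ χ′)      = sizeˢ χ ℕ.* sizeˢ χ′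
  sizeˢ (¬ˢ χ)         = sizeˢ χ
  sizeˢ (E ψ)          = sizeᵖ ψ

  sizeᵖ : ∀ {B V} → PathFormula B V → ℕ
  sizeᵖ (state χ) = sizeˢ χ
  sizeᵖ (ψ ∧ᵖ ψ′) = sizeᵖ ψ ℕ.* sizeᵖ ψ′
  sizeᵖ (¬ᵖ ψ)    = sizeᵖ ψ
  sizeᵖ (X ψ)     = sizeᵖ ψ
  sizeᵖ (G ψ)     = sizeᵖ ψ
  sizeᵖ (ψ U ψ′)  = sizeᵖ ψ ℕ.* sizeᵖ ψ′

mutual
  sizeˢ≢0 : ∀ {B V} (χ : StateFormula B V) → NonZero (sizeˢ χ)
  sizeˢ≢0 trueˢ          = _
  sizeˢ≢0 (constraint c) = size≢0 c
  sizeˢ≢0 (control _)    = _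
  sizeˢ≢0 (χ ∧ˢ χ′)      = ℕ.m*n≢0 _ _ {{sizeˢ≢0 χ}} {{sizeˢ≢0 χ′}}
  sizeˢ≢0 (¬ˢ χ)         = sizeˢ≢0 χ
  sizeˢ≢0 (E ψ)          = sizeᵖ≢0 ψ

  sizeᵖ≢0 : ∀ {B V} (ψ : PathFormula B V) → NonZero (sizeᵖ ψ)
  sizeᵖ≢0 (state χ) = sizeˢ≢0 χ
  sizeᵖ≢0 (ψ ∧ᵖ ψ′) = ℕ.m*n≢0 _ _ {{sizeᵖ≢0 ψ}} {{sizeᵖ≢0 ψ′}}
  sizeᵖ≢0 (¬ᵖ ψ)    = sizeᵖ≢0 ψ
  sizeᵖ≢0 (X ψ)     = sizeᵖ≢0 ψ
  sizeᵖ≢0 (G ψ)     = sizeᵖ≢0 ψ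
  sizeᵖ≢0 (ψ U ψ′)  = ℕ.m*n≢0 _ _ {{sizeᵖ≢0 ψ}} {{sizeᵖ≢0 ψ′}}

-- Equivalence of assignments

module Regions (N : ℕ) .{{_ : NonZero N}} where

  infix 4 _≋_ _≈_

  record _≋_ (y z : ℤ) : Set where
    field
      comparisons : ∀ ⊙ {d} → d ℕ.< N → compare ⊙ y (+ d) ⇔ compare ⊙ z (+ d)
      residues    : y ≡ z mod N
  open _≋_

  ≋-sym : ∀ {y z} → y ≋ z → z ≋ y
  ≋-sym {y} {z} y≋z = record
    { comparisons = λ ⊙ d<N → ⇔-sym (comparisons y≋z ⊙ d<N)
    ; residues    = mod-sym y z (residues y≋z)
    }

  ≋-refl : ∀ {y} → y ≋ y
  ≋-refl {y} = record
    { comparisons = λ _ _ → ⇔-id _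
    ; residues    = subst (λ x → N ℕ.∣ ∣ x ∣) (sym (ℤ.+-inverseʳ y)) (N ℕ.∣0)
    }

  record _≈_ {I : Set} (α β : I → ℤ) : Set where
    field
      alike      : ∀ i → α i ≋ β i
      equalities : ∀ i j → α i ≡ α j ⇔ β i ≡ β j
  open _≈_ public

  ≈-sym : {I : Set} {α β : I → ℤ} → α ≈ β → β ≈ α
  ≈-sym α≈β = record { alike = ≋-sym ∘ alike α≈β ; equalities = λ i j → ⇔-sym (equalities α≈β i j) }

  ≈-reindex : {I J : Set} {α β : I → ℤ} (f : J → I) → α ≈ β → (α ∘ f) ≈ (β ∘ f)
  ≈-reindex f α≈β = record { alike = alike α≈β ∘ f ; equalities = λ i j → equalities α≈β (f i) (f j) }

  -- Congruence modulo `N` implies congruence modulo each divisor `k`, so the two sides of a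
  -- congruence atom can be exchanged in turn.
  ≈-atom : ∀ {V} {α β : Assignment V} → α ≈ β → ∀ c → size c ℕ.∣ N → α ⊨ᵃ c → β ⊨ᵃ c
  ≈-atom α≈β (x ≐ y)     _   p = to (equalities α≈β x y) p
  -- `suc d` divides the non-zero `N`, hence `d` is below `N`.
  ≈-atom α≈β (x ⟨ ⊙ ⟩ d) d∣N p = to (comparisons (alike α≈β x) ⊙ (ℕ.∣⇒≤ d∣N)) p
  ≈-atom {α = α} {β} α≈β (x ≡[ k ] y ⊕ d) k∣N p =
    mod-trans (β x) (α x) (β y ℤ.+ + d) (mod-sym (α x) (β x) (ℕ.∣-trans k∣N (residues (alike α≈β x))))
      (mod-trans (α x) (α y ℤ.+ + d) (β y ℤ.+ + d) p
        (mod-+ʳ (α y) (β y) (+ d) (ℕ.∣-trans k∣N (residues (alike α≈β y)))))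
  ≈-atom {α = α} {β} α≈β (x ≡[ k ] d) k∣N p =
    mod-trans (β x) (α x) (+ d) (mod-sym (α x) (β x) (ℕ.∣-trans k∣N (residues (alike α≈β x)))) p

  residue-class : ∀ y t → y ≡ (+ (y %ℕ N) ℤ.+ t ℤ.* + N) mod N
  residue-class y t = Signed.∣⇒∣ᵤ (Signed.divides (y /ℕ N ℤ.- t)
    (trans (cong (ℤ._- (+ (y %ℕ N) ℤ.+ t ℤ.* + N)) (a≡a%ℕn+[a/ℕn]*n y N))
           (eqn (+ (y %ℕ N)) (y /ℕ N) t (+ N))))
    where
    eqn : ∀ r q t n → (r ℤ.+ q ℤ.* n) ℤ.- (r ℤ.+ t ℤ.* n) ≡ (q ℤ.- t) ℤ.* n
    eqn = solve-∀

  -- The condition on `t` fits both `+ suc j` and `-[1+ j ]`. It makes the candidates distinct and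
  -- bounds them, and as no multiplier is 0 they can be placed outside [0, N) on either side.
  fresh-in-residue-class : ∀ y (t : ℕ → ℤ) → (∀ j → ∣ t j ∣ ≡ suc j) → ∀ zs →
    ∃[ j ] let z = + (y %ℕ N) ℤ.+ t j ℤ.* + N in z ∉ zs × (∣ z ∣ ℕ.≤ N ℕ.+ suc (length zs) ℕ.* N)
  fresh-in-residue-class y t ∣t∣ zs =
    let j , j≤ , fresh = injective⇒fresh (λ j → + (y %ℕ N) ℤ.+ t j ℤ.* + N) injective zs
    in j , fresh , ℕ.≤-trans (ℤ.∣i+j∣≤∣i∣+∣j∣ (+ (y %ℕ N)) (t j ℤ.* + N))
      (ℕ.+-mono-≤ (ℕ.<⇒≤ (n%ℕd<d y N)) (begin
        ∣ t j ℤ.* + N ∣        ≡⟨ ℤ.abs-* (t j) (+ N) ⟩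
        ∣ t j ∣ ℕ.* N          ≡⟨ cong (ℕ._* N) (∣t∣ j) ⟩
        suc j ℕ.* N            ≤⟨ ℕ.*-monoˡ-≤ N (ℕ.s≤s j≤) ⟩
        suc (length zs) ℕ.* N  ∎))
    where
    open ℕ.≤-Reasoning
    injective : ∀ {i j} → + (y %ℕ N) ℤ.+ t i ℤ.* + N ≡ + (y %ℕ N) ℤ.+ t j ℤ.* + N → i ≡ j
    injective {i} {j} zᵢ≡zⱼ = ℕ.suc-injective (trans (sym (∣t∣ i)) (trans (cong ∣_∣
      (ℤ.*-cancelʳ-≡ (t i) (t j) (+ N) (∙-cancelˡ ℤ.+-0-abelianGroup (+ (y %ℕ N)) _ _ zᵢ≡zⱼ))) (∣t∣ j)))

  FreshTwin : ℤ → List ℤ → Set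
  FreshTwin y zs = ∃[ z ] y ≋ z × z ∉ zs × (∣ z ∣ ℕ.≤ N ℕ.+ suc (length zs) ℕ.* N)

  fresh-twin-above : ∀ y zs → + N ℤ.≤ y → FreshTwin y zs
  fresh-twin-above y zs N≤y with fresh-in-residue-class y (λ j → + suc j) (λ _ → refl) zs
  ... | j , z∉zs , ∣z∣≤ = z , record
    { comparisons = λ ⊙ d<N → mk⇔ (compare-above ⊙ (over N≤y d<N) (over N≤z d<N))
                                   (compare-above ⊙ (over N≤z d<N) (over N≤y d<N))
    ; residues    = residue-class y (+ suc j)
    } , z∉zs , ∣z∣≤
    where
    z = + (y %ℕ N) ℤ.+ (+ suc j) ℤ.* + N
    N≤z : + N ℤ.≤ z
    N≤z = subst (λ x → + N ℤ.≤ + (y %ℕ N) ℤ.+ x) (ℤ.pos-* (suc j) N)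
      (+≤+ (ℕ.≤-trans (ℕ.m≤m+n N (j ℕ.* N)) (ℕ.m≤n+m _ (y %ℕ N))))
    over : ∀ {x d} → + N ℤ.≤ x → d ℕ.< N → + d ℤ.< x
    over N≤x d<N = ℤ.<-≤-trans (+<+ d<N) N≤x

  fresh-twin-below : ∀ y zs → y ℤ.< + 0 → FreshTwin y zs
  fresh-twin-below y zs y<0 with fresh-in-residue-class y -[1+_] (λ _ → refl) zs
  ... | j , z∉zs , ∣z∣≤ = z , record
    { comparisons = λ ⊙ d<N → mk⇔ (compare-below ⊙ (under y<0) (under z<0))
                                   (compare-below ⊙ (under z<0) (under y<0))
    ; residues    = residue-class y -[1+ j ]
    } , z∉zs , ∣z∣≤
    where
    z = + (y %ℕ N) ℤ.+ -[1+ j ] ℤ.* + N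
    cancel : + (suc j ℕ.* N) ℤ.+ -[1+ j ] ℤ.* + N ≡ + 0
    cancel = trans (cong₂ ℤ._+_ (ℤ.pos-* (suc j) N) (sym (ℤ.neg-distribˡ-* (+ suc j) (+ N))))
                   (ℤ.+-inverseʳ (+ suc j ℤ.* + N))
    z<0 : z ℤ.< + 0
    -- With r the residue of `y`, add -(j + 1) N to both sides of r < (j + 1) N.
    z<0 = subst (z ℤ.<_) cancel (ℤ.+-monoˡ-< (-[1+ j ] ℤ.* + N)
      (+<+ (ℕ.<-≤-trans (n%ℕd<d y N) (ℕ.m≤m+n N (j ℕ.* N)))))
    under : ∀ {x d} → x ℤ.< + 0 → x ℤ.< + d
    under x<0 = ℤ.<-≤-trans x<0 (+≤+ ℕ.z≤n)

  -- Extending finite matchings one value at a time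

  record Matching (ps : List (ℤ × ℤ)) : Set where
    field
      twins   : ∀ {y z} → (y , z) ∈ ps → y ≋ z
      pairing : ∀ {y z y′ z′} → (y , z) ∈ ps → (y′ , z′) ∈ ps → y ≡ y′ ⇔ z ≡ z′
  open Matching

  Matching⇒≈ : ∀ {I ps} {α β : I → ℤ} → Matching ps → (∀ i → (α i , β i) ∈ ps) → α ≈ β
  Matching⇒≈ M ∈ps = record { alike = λ i → twins M (∈ps i) ; equalities = λ i j → pairing M (∈ps i) (∈ps j) }

  ≈⇒Matching : ∀ {n} {α β : Fin n → ℤ} → α ≈ β → Matching (tabulate (λ i → α i , β i))
  ≈⇒Matching α≈β = record
    { twins   = λ p → at-index (∈-tabulate⁻ p)
    ; pairing = λ p q → at-indices (∈-tabulate⁻ p) (∈-tabulate⁻ q)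
    }
    where
    at-index : ∀ {y z} → _ → y ≋ z
    at-index (i , refl) = alike α≈β i
    at-indices : ∀ {y z y′ z′} → _ → _ → y ≡ y′ ⇔ z ≡ z′
    at-indices (i , refl) (j , refl) = equalities α≈β i j

  -- Since `y` and `z` are both new, an equality with an older entry fails on both sides.
  Matching-∷ : ∀ {ps y z} → Matching ps → y ≋ z → y ∉ map proj₁ ps → z ∉ map proj₂ ps → Matching ((y , z) ∷ ps)
  Matching-∷ M y≋z y∉ z∉ = record
    { twins   = λ { (here refl) → y≋z ; (there p) → twins M p }
    ; pairing = λ where
        (here refl) (here refl) → mk⇔ (λ _ → refl) (λ _ → refl)
        (here refl) (there q)   → mk⇔ (λ { refl → contradiction (∈-map⁺ proj₁ q) y∉ })
                                      (λ { refl → contradiction (∈-map⁺ proj₂ q) z∉ })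
        (there p)   (here refl) → mk⇔ (λ { refl → contradiction (∈-map⁺ proj₁ p) y∉ })
                                      (λ { refl → contradiction (∈-map⁺ proj₂ p) z∉ })
        (there p)   (there q)   → pairing M p q
    }

  -- A value in [0, N) can only be answered by itself, since comparison with it pins it down;
  -- outside there is room on the same side.
  fresh-twin : ∀ {ps} → Matching ps → ∀ y → y ∉ map proj₁ ps → FreshTwin y (map proj₂ ps)
  fresh-twin {ps} M -[1+ n ] y∉ = fresh-twin-below _ _ -<+
  fresh-twin {ps} M (+ d) y∉ with d ℕ.<? N
  ... | no  d≮N = fresh-twin-above _ _ (+≤+ (ℕ.≮⇒≥ d≮N))
  ... | yes d<N = + d , ≋-refl , d∉ , ℕ.≤-trans (ℕ.<⇒≤ d<N) (ℕ.m≤m+n N _)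
    where
    d∉ : + d ∉ map proj₂ ps
    -- If `d` already answered some y′, then y′ would equal `d`, which would thus have been matched
    -- before.
    d∉ d∈ with ∈-map⁻ proj₂ d∈
    ... | (y′ , _) , p , refl =
      y∉ (subst (_∈ map proj₁ ps) (from (comparisons (twins M p) eq d<N) refl) (∈-map⁺ proj₁ p))

  -- P is trivial when answering in the full system, and membership in the box in the finite one.
  module _ (L : ℕ) (P : ℤ → Set) (small⇒P : ∀ {z} → ∣ z ∣ ℕ.≤ N ℕ.+ suc L ℕ.* N → P z) where

    record Extension {n} (ps : List (ℤ × ℤ)) (β : Fin n → ℤ) : Set where
      field
        {pairs}  : List (ℤ × ℤ)
        matching : Matching pairs
        includes : ∀ {p} → p ∈ ps → p ∈ pairs
        partner  : Fin n → ℤ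
        partnerP : ∀ i → P (partner i)
        paired   : ∀ i → (β i , partner i) ∈ pairs
    open Extension

    -- A repeated value keeps its partner, any other gets a fresh twin. The sum `n + length ps`
    -- never grows, so at most `L` values have to be avoided and one size bound suffices throughout.
    extend : ∀ n {ps} → Matching ps → All (P ∘ proj₂) ps → n ℕ.+ length ps ℕ.≤ L →
             (β : Fin n → ℤ) → Extension ps β
    extend zero M _ _ β = record
      { matching = M ; includes = id ; partner = λ () ; partnerP = λ () ; paired = λ () }
    extend (suc n) {ps} M Ps n+∣ps∣≤L β with β zero ∈? map proj₁ ps
    ... | yes y∈ with ∈-map⁻ proj₁ y∈
    ...   | (_ , z) , yz∈ , refl = record
      { matching = matching E
      ; includes = includes E
      ; partner  = λ { zero → z ; (suc i) → partner E i }
      ; partnerP = λ { zero → All.lookup Ps yz∈ ; (suc i) → partnerP E i }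
      ; paired   = λ { zero → includes E yz∈ ; (suc i) → paired E i }
      }
      where E = extend n M Ps (ℕ.≤-trans (ℕ.n≤1+n _) n+∣ps∣≤L) (β ∘ suc)
    extend (suc n) {ps} M Ps n+∣ps∣≤L β | no y∉ with fresh-twin M (β zero) y∉
    ...   | z , y≋z , z∉ , ∣z∣≤ = record
      { matching = matching E
      ; includes = includes E ∘ there
      ; partner  = λ { zero → z ; (suc i) → partner E i }
      ; partnerP = λ { zero → Pz ; (suc i) → partnerP E i }
      ; paired   = λ { zero → includes E (here refl) ; (suc i) → paired E i }
      }
      where
      Pz = small⇒P (ℕ.≤-trans ∣z∣≤ (ℕ.+-monoʳ-≤ N (ℕ.*-monoˡ-≤ N (ℕ.s≤s
        (subst (ℕ._≤ L) (sym (length-map proj₂ ps))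
          (ℕ.≤-trans (ℕ.m≤n+m (length ps) (suc n)) n+∣ps∣≤L))))))
      E = extend n (Matching-∷ M y≋z y∉ z∉) (Pz ∷ Ps)
            (subst (ℕ._≤ L) (sym (ℕ.+-suc n (length ps))) n+∣ps∣≤L) (β ∘ suc)

  -- Only finitely many constants lie below `N`, and the residue of `z` is a natural number, as
  -- atoms require, even if `z` is negative.
  definable-≋ : ∀ {V} (x : V) z → Definable (λ α → α x ≋ z)
  definable-≋ x z = definable-⇔ equiv
    (definable-× (definable-∀⊙ λ ⊙ → definable-∀ λ d → same ⊙ (Fin.toℕ d))
                 (definable-atom (x ≡[ N ] (z %ℕ N))))
    where
    r = + (z %ℕ N)
    z≡r : z ≡ r mod N
    z≡r = subst (z ≡_mod N) (ℤ.+-identityʳ r) (residue-class z (+ 0))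
    Same : Comparison → ℕ → Assignment _ → Set
    Same ⊙ d α = compare ⊙ (α x) (+ d) ⇔ compare ⊙ z (+ d)
    same : ∀ ⊙ d → Definable (Same ⊙ d)
    same ⊙ d = definable-equiv (definable-atom (x ⟨ ⊙ ⟩ d)) (definable-dec (compare? ⊙ z (+ d)))
    equiv : ∀ α → ((∀ ⊙ (d : Fin N) → Same ⊙ (Fin.toℕ d) α) × α x ≡ r mod N) ⇔ α x ≋ z
    equiv α = mk⇔
      (λ (f , αx≡r) → record
        { comparisons = λ ⊙ d<N → subst (λ d → Same ⊙ d α) (Fin.toℕ-fromℕ< d<N) (f ⊙ (Fin.fromℕ< d<N))
        ; residues    = mod-trans (α x) r z αx≡r (mod-sym z r z≡r) })
      (λ αx≋z → (λ ⊙ d → comparisons αx≋z ⊙ (Fin.toℕ<n d)) , mod-trans (α x) z r (residues αx≋z) z≡r)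

  definable-≈ : ∀ {n} (β : Assignment (Fin n)) → Definable (_≈ β)
  definable-≈ β = definable-⇔
    (λ α → mk⇔ (λ (a , e) → record { alike = a ; equalities = e }) (λ α≈β → alike α≈β , equalities α≈β))
    (definable-× (definable-∀ λ i → definable-≋ i (β i))
                 (definable-∀ λ i → definable-∀ λ j →
                   definable-equiv (definable-atom (i ≐ j)) (definable-dec (β i ℤ.≟ β j))))

-- Model checking

module Box (W : ℕ) where

  width : ℕ
  width = suc W ℕ.+ suc W

  -- Zero has two codes; the search relies only on every value of the box having one.
  signed : Fin (suc W) ⊎ Fin (suc W) → ℤ
  signed (inj₁ i) = + Fin.toℕ i
  signed (inj₂ i) = ℤ.- (+ Fin.toℕ i)

  value : Fin width → ℤ
  value = signed ∘ splitAt (suc W)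

  value-surjective : ∀ {z} → ∣ z ∣ ℕ.≤ W → ∃[ c ] value c ≡ z
  value-surjective {+ n} n≤W = Fin.fromℕ< (ℕ.s≤s n≤W) ↑ˡ suc W ,
    trans (cong signed (Fin.splitAt-↑ˡ (suc W) _ (suc W))) (cong +_ (Fin.toℕ-fromℕ< (ℕ.s≤s n≤W)))
  value-surjective { -[1+ n ]} n<W = suc W ↑ʳ Fin.fromℕ< (ℕ.s≤s n<W) ,
    trans (cong signed (Fin.splitAt-↑ʳ (suc W) (suc W) _)) (cong (λ n → ℤ.- (+ n)) (Fin.toℕ-fromℕ< (ℕ.s≤s n<W)))

copy-≟ : ∀ {n} → DecidableEquality (Copy (Fin n))
copy-≟ (v ʳ) (w ʳ) = map′ (cong _ʳ) (λ { refl → refl }) (v Fin.≟ w)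
copy-≟ (v ʷ) (w ʷ) = map′ (cong _ʷ) (λ { refl → refl }) (v Fin.≟ w)
copy-≟ (v ʳ) (w ʷ) = no λ ()
copy-≟ (v ʷ) (w ʳ) = no λ ()

module _ (𝓑 : IPC-DDSA) where
  open IPC-DDSA 𝓑 renaming (T to 𝓣)
  open Semantics 𝓑

  step? : ∀ a b α b′ α′ → Dec (Step a b α b′ α′)
  step? a b α b′ α′ = map′
    (λ (t , i , g) → record { transition = t ; inertia = i ; guarded = g })
    (λ s → Step.transition s , Step.inertia s , Step.guarded s)
    ((b , a , b′) ∈ₜ? 𝓣 ×-dec
     Fin.all? (λ v → ¬? (v ʷ ∈ᵥ? concatMap vars (guard a)) →-dec (α′ v ℤ.≟ α v)) ×-dec
     All.all? (readWrite α α′ ⊨ᵃ?_) (guard a))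
    where
    open DecMembership (≡-dec Fin._≟_ (≡-dec Fin._≟_ Fin._≟_)) using () renaming (_∈?_ to _∈ₜ?_)
    open DecMembership (copy-≟ {#vars}) using () renaming (_∈?_ to _∈ᵥ?_)

  ⟶? : ∀ c c′ → Dec (c ⟶ c′)
  ⟶? (b , α) (b′ , α′) = Fin.any? (λ a → step? a b α b′ α′)

  -- Expansion laws along a run

  module _ {b α c c′} {s : (b , α) ⟶ c} {ρ : Run c c′} where

    -- No operator looks at earlier positions, so dropping the first step of the run only shifts the
    -- indices.
    ⊨ᵖ-suc : ∀ ψ i → (_,_⊨ᵖ_ (s ◅ ρ) (suc i) ψ) ⇔ (ρ , i ⊨ᵖ ψ)
    ⊨ᵖ-suc (state χ)   i = ⇔-id _
    ⊨ᵖ-suc (ψ ∧ᵖ ψ′)   i = ⊨ᵖ-suc ψ i ×-⇔ ⊨ᵖ-suc ψ′ i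
    ⊨ᵖ-suc (¬ᵖ ψ)      i = ¬-cong-⇔ (⊨ᵖ-suc ψ i)
    ⊨ᵖ-suc (X ψ)       i = mk⇔ (λ { (suc j , j≡ , p) → j , ℕ.suc-injective j≡ , to (⊨ᵖ-suc ψ j) p })
                               (λ { (j , j≡ , p) → suc j , cong suc j≡ , from (⊨ᵖ-suc ψ j) p })
    ⊨ᵖ-suc (G ψ)       i = mk⇔ (λ f j i≤j → to (⊨ᵖ-suc ψ j) (f (suc j) (ℕ.s≤s i≤j)))
                               (λ { f (suc j) (ℕ.s≤s i≤j) → from (⊨ᵖ-suc ψ j) (f j i≤j) })
    ⊨ᵖ-suc (ψ U ψ′)    i = mk⇔
      (λ { (suc m , ℕ.s≤s i≤m , p , f) → m , i≤m , to (⊨ᵖ-suc ψ′ m) p ,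
             λ j i≤j j<m → to (⊨ᵖ-suc ψ j) (f (suc j) (ℕ.s≤s i≤j) (ℕ.s≤s j<m)) })
      (λ { (m , i≤m , p , f) → suc m , ℕ.s≤s i≤m , from (⊨ᵖ-suc ψ′ m) p ,
             λ { (suc j) (ℕ.s≤s i≤j) (ℕ.s≤s j<m) → from (⊨ᵖ-suc ψ j) (f j i≤j j<m) } })

    -- Like the two laws that follow, this reduces truth at the start to truth of subformulas there
    -- and truth on the tail, so that a run can be evaluated from its end.
    X-◅ : ∀ ψ → (_,_⊨ᵖ_ (s ◅ ρ) zero (X ψ)) ⇔ (ρ , zero ⊨ᵖ ψ)
    X-◅ ψ = mk⇔ (λ { (suc zero , _ , p) → to (⊨ᵖ-suc ψ zero) p })
                (λ p → suc zero , refl , from (⊨ᵖ-suc ψ zero) p)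

    G-◅ : ∀ ψ → (_,_⊨ᵖ_ (s ◅ ρ) zero (G ψ)) ⇔ ((_,_⊨ᵖ_ (s ◅ ρ) zero ψ) × (ρ , zero ⊨ᵖ G ψ))
    G-◅ ψ = mk⇔ (λ f → f zero ℕ.z≤n , λ j _ → to (⊨ᵖ-suc ψ j) (f (suc j) ℕ.z≤n))
                (λ { (p , f) zero _ → p ; (p , f) (suc j) _ → from (⊨ᵖ-suc ψ j) (f j ℕ.z≤n) })

    U-◅ : ∀ ψ ψ′ → (_,_⊨ᵖ_ (s ◅ ρ) zero (ψ U ψ′)) ⇔
          ((_,_⊨ᵖ_ (s ◅ ρ) zero ψ′) ⊎ (_,_⊨ᵖ_ (s ◅ ρ) zero ψ) × (ρ , zero ⊨ᵖ ψ U ψ′))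
    U-◅ ψ ψ′ = mk⇔
      (λ { (zero , _ , p , _) → inj₁ p
         ; (suc m , _ , p , f) → inj₂ (f zero ℕ.z≤n (ℕ.s≤s ℕ.z≤n) , m , ℕ.z≤n , to (⊨ᵖ-suc ψ′ m) p ,
             λ j _ j<m → to (⊨ᵖ-suc ψ j) (f (suc j) ℕ.z≤n (ℕ.s≤s j<m))) })
      (λ { (inj₁ p) → zero , ℕ.z≤n , p , λ _ _ ()
         ; (inj₂ (q , m , _ , p , f)) → suc m , ℕ.z≤n , from (⊨ᵖ-suc ψ′ m) p ,
             λ { zero _ _ → q ; (suc j) _ (ℕ.s≤s j<m) → from (⊨ᵖ-suc ψ j) (f j ℕ.z≤n j<m) } })

  observation : {O : Set} → (Config → Maybe O → O) → ∀ {c c′} → Run c c′ → O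
  observation observe {c} ε       = observe c nothing
  observation observe {c} (_ ◅ ρ) = observe c (just (observation observe ρ))

  -- Fusion law of the fold: it extracts the observation of a component monitor from that of a
  -- product.
  observation-map : ∀ {O O′} {f : Config → Maybe O → O} {g : Config → Maybe O′ → O′} (h : O → O′) →
    (∀ c m → h (f c m) ≡ g c (Maybe.map h m)) →
    ∀ {c c′} (ρ : Run c c′) → h (observation f ρ) ≡ observation g ρ
  observation-map {g = g} h hom {c} ε       = hom c nothing
  observation-map {g = g} h hom {c} (_ ◅ ρ) =
    trans (hom c _) (cong (g c ∘ just) (observation-map h hom ρ))

  -- Bisimulation with a finite box

  module _ (N : ℕ) .{{_ : NonZero N}} (guards∣N : ∀ a → All (λ c → size c ℕ.∣ N) (guard a)) where
    open Regions N
    open Extension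

    ≈-respʳ : ∀ {I} {α β β′ : I → ℤ} → (∀ i → β i ≡ β′ i) → α ≈ β → α ≈ β′
    ≈-respʳ {α = α} β≗β′ α≈β = record
      { alike      = λ i → subst (α i ≋_) (β≗β′ i) (alike α≈β i)
      ; equalities = λ i j → subst₂ (λ y z → α i ≡ α j ⇔ y ≡ z) (β≗β′ i) (β≗β′ j) (equalities α≈β i j)
      }

    -- Inertia is an equality between the two copies of a variable, so equivalence on read and write
    -- copies together preserves it along with the guards.
    step-transfer : ∀ {a b b′ α β α′ β′} → readWrite α α′ ≈ readWrite β β′ → Step a b α b′ α′ → Step a b β b′ β′
    step-transfer {a} e s = record
      { transition = Step.transition s
      ; inertia    = λ v ¬w → to (equalities e (v ʷ) (v ʳ)) (Step.inertia s v ¬w)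
      ; guarded    = All.zipWith (λ {c} (d , p) → ≈-atom e c d p) (guards∣N a , Step.guarded s)
      }

    -- Answering a step needs at most one pair for each read and each written value, hence at most
    -- `#vars + #vars` pairs.
    bound : ℕ
    bound = N ℕ.+ suc (#vars ℕ.+ #vars) ℕ.* N

    open Box bound

    Code : Set
    Code = Fin (width ℕ.^ #vars)

    decode : Code → Assignment Var
    decode k v = value (finToFun k v)

    encode : {α : Assignment Var} → (∀ v → ∃[ c ] value c ≡ α v) → ∃[ k ] (∀ v → α v ≡ decode k v)
    encode coded = funToFin (proj₁ ∘ coded) ,
      λ v → sym (trans (cong value (Fin.finToFun-funToFin (proj₁ ∘ coded) v)) (proj₂ (coded v)))

    representative : ∀ α → ∃[ k ] α ≈ decode k
    representative α = proj₁ k , ≈-respʳ (proj₂ k) (Matching⇒≈ (matching E) (paired E))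
      where
      E = extend (#vars ℕ.+ #vars) (λ z → ∃[ c ] value c ≡ z) value-surjective #vars {[]}
            (record { twins = λ () ; pairing = λ () }) []
            (ℕ.+-monoʳ-≤ #vars ℕ.z≤n) α
      k = encode (partnerP E)

    module _ (P : ℤ → Set) (small⇒P : ∀ {z} → ∣ z ∣ ℕ.≤ bound → P z) where

      -- The matching of the old values is extended by the new ones, so equalities between old and
      -- new values are respected too.
      respond : ∀ {α β} → α ≈ β → (∀ v → P (β v)) → ∀ α′ →
                ∃[ β′ ] (∀ v → P (β′ v)) × readWrite α α′ ≈ readWrite β β′
      respond {α} {β} α≈β Pβ α′ = partner E , partnerP E , Matching⇒≈ (matching E) λ where
          (v ʳ) → includes E (∈-tabulate⁺ v)
          (v ʷ) → paired E v
        where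
        E = extend (#vars ℕ.+ #vars) P small⇒P #vars (≈⇒Matching α≈β) (All.tabulate⁺ Pβ)
              (ℕ.≤-reflexive (cong (#vars ℕ.+_) (length-tabulate (λ v → α v , β v)))) α′

    simulate : ∀ {b α β b′ α′} → α ≈ β → (b , α) ⟶ (b′ , α′) → ∃[ β′ ] α′ ≈ β′ × (b , β) ⟶ (b′ , β′)
    simulate {α′ = α′} α≈β (a , s) with respond (const ⊤) _ α≈β _ α′
    ... | β′ , _ , e = β′ , ≈-reindex _ʷ e , a , step-transfer e s

    -- Reused partners are coded because they are values of `decode k`, fresh ones because they are
    -- small; so the answer stays in the box.
    simulate-coded : ∀ {b α k b′ α′} → α ≈ decode k → (b , α) ⟶ (b′ , α′) →
                     ∃[ k′ ] α′ ≈ decode k′ × (b , decode k) ⟶ (b′ , decode k′)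
    simulate-coded {k = k} {α′ = α′} α≈k (a , s)
      with respond (λ z → ∃[ c ] value c ≡ z) value-surjective α≈k (λ v → finToFun k v , refl) α′
    ... | β′ , coded , e with encode coded
    ...   | k′ , β′≗k′ = k′ , ≈-reindex _ʷ e′ , a , step-transfer e′ s
      where e′ = ≈-respʳ (λ { (v ʳ) → refl ; (v ʷ) → β′≗k′ v }) e

    -- Monitors for path formulas

    record Settled (χ : IPCProperty) : Set where
      field
        decide    : ∀ c → Dec (c ⊨ χ)
        invariant : ∀ {b α β} → α ≈ β → (b , α) ⊨ χ → (b , β) ⊨ χ
    open Settled

    -- A run is read backwards: each configuration updates the observation of the run's tail,
    -- and the observation of the whole run decides the formula at its first position.
    record Monitor (ψ : PathFormula State Var) : Set₁ where
      field
        {Obs}       : Set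
        obs-finite  : Finite Obs
        observe     : Config → Maybe Obs → Obs
        observe-inv : ∀ {b α β} → α ≈ β → ∀ m → observe (b , α) m ≡ observe (b , β) m
        accept      : Obs → Bool
        correct     : ∀ {c c′} (ρ : Run c c′) → (ρ , zero ⊨ᵖ ψ) ⇔ T (accept (observation observe ρ))
    open Monitor

    -- `decide` supplies the observation, and `invariant` its agreement on equivalent
    -- configurations.
    state-monitor : ∀ {χ} → Settled χ → Monitor (state χ)
    state-monitor S = record
      { obs-finite  = Bool-finite
      ; observe     = λ c _ → ⌊ decide S c ⌋
      ; observe-inv = λ {b} {α} {β} α≈β _ →
          trans (isYes≗does (decide S (b , α)))
            (trans (does-⇔ (mk⇔ (invariant S α≈β) (invariant S (≈-sym α≈β))) (decide S (b , α)) (decide S (b , β)))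
              (sym (isYes≗does (decide S (b , β)))))
      ; accept      = id
      ; correct     = λ { {c} ε → mk⇔ fromWitness toWitness ; {c} (_ ◅ _) → mk⇔ fromWitness toWitness }
      }

    -- Every run has exactly one observation, so complementing acceptance complements the formula.
    ¬-monitor : ∀ {ψ} → Monitor ψ → Monitor (¬ᵖ ψ)
    ¬-monitor M = record
      { obs-finite  = obs-finite M
      ; observe     = observe M
      ; observe-inv = observe-inv M
      ; accept      = not ∘ accept M
      ; correct     = λ ρ → T-not _ ∘⇔ ¬-cong-⇔ (correct M ρ)
      }
      where
      T-not : ∀ b → (¬ T b) ⇔ T (not b)
      T-not true  = mk⇔ (λ f → f _) (λ ())
      T-not false = mk⇔ _ (λ _ ())

    correct-at : ∀ {ψ} (M : Monitor ψ) {c c′} (ρ : Run c c′) {o} → o ≡ observation (observe M) ρ →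
                 (ρ , zero ⊨ᵖ ψ) ⇔ T (accept M o)
    correct-at M ρ refl = correct M ρ

    ∧-monitor : ∀ {ψ ψ′} → Monitor ψ → Monitor ψ′ → Monitor (ψ ∧ᵖ ψ′)
    ∧-monitor M M′ = record
      { obs-finite  = obs-finite M ×-finite obs-finite M′
      ; observe     = observe-both
      ; observe-inv = λ α≈β m → cong₂ _,_ (observe-inv M α≈β _) (observe-inv M′ α≈β _)
      ; accept      = λ (o , o′) → accept M o ∧ accept M′ o′
      ; correct     = λ ρ → ⇔-sym T-∧ ∘⇔
          (correct-at M  ρ (observation-map {f = observe-both} proj₁ (λ _ _ → refl) ρ) ×-⇔
           correct-at M′ ρ (observation-map {f = observe-both} proj₂ (λ _ _ → refl) ρ))
      }
      where
      observe-both : Config → Maybe (Obs M × Obs M′) → Obs M × Obs M′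
      observe-both c m = observe M c (Maybe.map proj₁ m) , observe M′ c (Maybe.map proj₂ m)

    X-monitor : ∀ {ψ} → Monitor ψ → Monitor (X ψ)
    X-monitor {ψ} M = record
      { obs-finite  = Bool-finite ×-finite obs-finite M
      ; observe     = observe-X
      ; observe-inv = λ α≈β m → cong (_ ,_) (observe-inv M α≈β _)
      ; accept      = proj₁
      ; correct     = λ where
          ε       → mk⇔ (λ { (zero , () , _) ; (suc () , _) }) (λ ())
          (_ ◅ ρ) → correct-at M ρ (observation-map {f = observe-X} proj₂ (λ _ _ → refl) ρ) ∘⇔ X-◅ ψ
      }
      where
      observe-X : Config → Maybe (Bool × Obs M) → Bool × Obs M
      -- The Boolean is the verdict of `M` on the tail; the last position has no successor, hence
      -- the default `false`.
      observe-X c m = maybe′ (accept M ∘ proj₂) false m , observe M c (Maybe.map proj₂ m)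

    G-monitor : ∀ {ψ} → Monitor ψ → Monitor (G ψ)
    G-monitor {ψ} M = record
      { obs-finite  = Bool-finite ×-finite obs-finite M
      ; observe     = observe-G
      ; observe-inv = λ α≈β m → cong (λ o → accept M o ∧ maybe′ proj₁ true m , o) (observe-inv M α≈β _)
      ; accept      = proj₁
      ; correct     = correct-G
      }
      where
      observe-G : Config → Maybe (Bool × Obs M) → Bool × Obs M
      -- Past the end `G` is vacuously true, hence the default `true`.
      observe-G c m = let o = observe M c (Maybe.map proj₂ m) in accept M o ∧ maybe′ proj₁ true m , o
      tail : ∀ {c c′} (ρ : Run c c′) → proj₂ (observation observe-G ρ) ≡ observation (observe M) ρ
      tail = observation-map {f = observe-G} proj₂ (λ _ _ → refl)
      correct-G : ∀ {c c′} (ρ : Run c c′) → (ρ , zero ⊨ᵖ G ψ) ⇔ T (proj₁ (observation observe-G ρ))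
      correct-G ε       = ⇔-sym T-∧ ∘⇔ (correct M ε ×-⇔ ⇔-id ⊤) ∘⇔
        mk⇔ (λ f → f zero ℕ.z≤n , _) (λ { (p , _) zero _ → p })
      correct-G (s ◅ ρ) = ⇔-sym T-∧ ∘⇔ (correct-at M (s ◅ ρ) (tail (s ◅ ρ)) ×-⇔ correct-G ρ) ∘⇔ G-◅ ψ

    U-monitor : ∀ {ψ ψ′} → Monitor ψ → Monitor ψ′ → Monitor (ψ U ψ′)
    U-monitor {ψ} {ψ′} M M′ = record
      { obs-finite  = Bool-finite ×-finite obs-finite M ×-finite obs-finite M′
      ; observe     = observe-U
      ; observe-inv = λ α≈β m → cong₂ (λ o o′ → accept M′ o′ ∨ (accept M o ∧ maybe′ proj₁ false m) , o , o′)
                        (observe-inv M α≈β _) (observe-inv M′ α≈β _)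
      ; accept      = proj₁
      ; correct     = correct-U
      }
      where
      observe-U : Config → Maybe (Bool × Obs M × Obs M′) → Bool × Obs M × Obs M′
      -- The default `false` says that no witness lies past the end.
      observe-U c m =
        let o  = observe M  c (Maybe.map (proj₁ ∘ proj₂) m)
            o′ = observe M′ c (Maybe.map (proj₂ ∘ proj₂) m)
        in accept M′ o′ ∨ (accept M o ∧ maybe′ proj₁ false m) , o , o′
      correct-left : ∀ {c c′} (ρ : Run c c′) → (ρ , zero ⊨ᵖ ψ) ⇔ T (accept M (proj₁ (proj₂ (observation observe-U ρ))))
      correct-left ρ = correct-at M ρ (observation-map {f = observe-U} (proj₁ ∘ proj₂) (λ _ _ → refl) ρ)
      correct-right : ∀ {c c′} (ρ : Run c c′) → (ρ , zero ⊨ᵖ ψ′) ⇔ T (accept M′ (proj₂ (proj₂ (observation observe-U ρ))))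
      correct-right ρ = correct-at M′ ρ (observation-map {f = observe-U} (proj₂ ∘ proj₂) (λ _ _ → refl) ρ)
      correct-U : ∀ {c c′} (ρ : Run c c′) → (ρ , zero ⊨ᵖ ψ U ψ′) ⇔ T (proj₁ (observation observe-U ρ))
      correct-U ε       = ⇔-sym T-∨ ∘⇔
        (correct-right ε ⊎-⇔ ⇔-sym T-∧ ∘⇔ (correct-left ε ×-⇔ ⇔-id ⊥)) ∘⇔
        mk⇔ (λ { (zero , _ , p , _) → inj₁ p })
            (λ { (inj₁ p) → zero , ℕ.z≤n , p , λ _ _ () })
      correct-U (s ◅ ρ) = ⇔-sym T-∨ ∘⇔
        (correct-right (s ◅ ρ) ⊎-⇔ ⇔-sym T-∧ ∘⇔ (correct-left (s ◅ ρ) ×-⇔ correct-U ρ)) ∘⇔ U-◅ ψ ψ′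

    -- Deciding the existential path quantifier

    module Existential {ψ} (M : Monitor ψ) where

      obs : ∀ {c c′} → Run c c′ → Obs M
      obs = observation (observe M)

      -- The steps are simulated in turn, and `observe-inv` turns equivalence of the visited
      -- configurations into equality of observations.
      run-transfer : ∀ {b α β b′ α′} → α ≈ β → (ρ : Run (b , α) (b′ , α′)) →
                     ∃[ β′ ] Σ (Run (b , β) (b′ , β′)) λ ρ′ → obs ρ ≡ obs ρ′
      run-transfer α≈β ε       = _ , ε , observe-inv M α≈β nothing
      run-transfer α≈β (s ◅ ρ) =
        let _ , α≈β′ , s′ = simulate α≈β s
            _ , ρ′ , same = run-transfer α≈β′ ρ
        in _ , s′ ◅ ρ′ , trans (observe-inv M α≈β _) (cong (observe M _ ∘ just) same)

      E-transfer : ∀ {b α β} → α ≈ β → (b , α) ⊨ E ψ → (b , β) ⊨ E ψ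
      E-transfer α≈β (record { run = ρ ; isFinal = f } , p) =
        let _ , ρ′ , same = run-transfer α≈β ρ
        in record { run = ρ′ ; isFinal = f } ,
           from (correct M ρ′) (subst (T ∘ accept M) same (to (correct M ρ) p))

      Node : Set
      Node = (State × Code) × Obs M

      node-finite : Finite Node
      node-finite = (Fin-finite _ ×-finite Fin-finite _) ×-finite obs-finite M

      config : State × Code → Config
      config (b , k) = b , decode k

      -- The second component of a node guesses the observation of the rest of the run. An edge
      -- checks the guess against the one at its target, `Final` checks it against the end of the
      -- run; so walks are searched forwards although the monitor reads backwards.
      Edge : Node → Node → Set
      Edge (n , o) (n′ , o′) = config n ⟶ config n′ × o ≡ observe M (config n) (just o′)

      Final : Node → Set
      Final (n , o) = proj₁ n ∈ₛ B-F × o ≡ observe M (config n) nothing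

      walk⇒run : ∀ {p q} → Star Edge p q → Final q →
                 Σ (FRuns (config (proj₁ p))) λ ρ → proj₂ p ≡ obs (FRuns.run ρ)
      walk⇒run ε                 (f , o≡) = record { run = ε ; isFinal = f } , o≡
      walk⇒run ((s , o≡) ◅ walk) final    =
        let record { run = ρ ; isFinal = f } , same = walk⇒run walk final
        in record { run = s ◅ ρ ; isFinal = f } , trans o≡ (cong (observe M _ ∘ just) same)

      -- The run may leave the box, so it is replayed inside, with the observations of the original
      -- run as guesses.
      run⇒walk : ∀ {b α k b′ α′} → α ≈ decode k → (ρ : Run (b , α) (b′ , α′)) → b′ ∈ₛ B-F →
                 ∃[ q ] Star Edge ((b , k) , obs ρ) q × Final q
      run⇒walk α≈k ε       f = _ , ε , f , observe-inv M α≈k nothing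
      run⇒walk α≈k (s ◅ ρ) f =
        let _ , α≈k′ , s′ = simulate-coded α≈k s
            _ , walk , final = run⇒walk α≈k′ ρ f
        in _ , (s′ , observe-inv M α≈k _) ◅ walk , final

      E? : ∀ c → Dec (c ⊨ E ψ)
      E? (b , α) with representative α
      ... | k , α≈k = map′
        -- The walk yields a run from the representative, which is then carried over to `α`.
        (λ (o , p , _ , walk , final) →
          let ρ , same = walk⇒run walk final
          in E-transfer (≈-sym α≈k) (ρ , from (correct M _) (subst (T ∘ accept M) same p)))
        (λ (record { run = ρ ; isFinal = f } , p) → obs ρ , to (correct M ρ) p , run⇒walk α≈k ρ f)
        -- Try every accepted guess at the representative and every final node reachable from it.
        (∃? (obs-finite M) λ o → T? (accept M o) ×-dec
         ∃? node-finite λ q → Star? node-finite edge? ((b , k) , o) q ×-dec final? q)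
        where
        open Reachability
        open Finite (obs-finite M) using (_≟_)
        edge? : Decidable Edge
        edge? (n , o) (n′ , o′) = ⟶? (config n) (config n′) ×-dec (o ≟ observe M (config n) (just o′))
        final? : ∀ q → Dec (Final q)
        final? (n , o) = (proj₁ n Subset.∈? B-F) ×-dec (o ≟ observe M (config n) nothing)

      E-settled : Settled (E ψ)
      E-settled = record { decide = E? ; invariant = E-transfer }

    -- Induction on formulas

    mutual
      settled : ∀ χ → sizeˢ χ ℕ.∣ N → Settled χ
      settled trueˢ          _ = record { decide = λ _ → yes _ ; invariant = λ _ _ → _ }
      settled (constraint φ) d = record { decide = λ (_ , α) → α ⊨ᵃ? φ ; invariant = λ α≈β → ≈-atom α≈β φ d }
      settled (control b′)   _ = record { decide = λ (b , _) → b Fin.≟ b′ ; invariant = λ _ → id }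
      settled (χ ∧ˢ χ′)      d = record
        { decide    = λ c → decide S c ×-dec decide S′ c
        ; invariant = λ α≈β (p , q) → invariant S α≈β p , invariant S′ α≈β q
        }
        where
        S  = settled χ  (ℕ.m*n∣⇒m∣ (sizeˢ χ) (sizeˢ χ′) d)
        S′ = settled χ′ (ℕ.m*n∣⇒n∣ (sizeˢ χ) (sizeˢ χ′) d)
      settled (¬ˢ χ)         d = record
        { decide    = ¬? ∘ decide S
        -- Negation reverses the direction of transfer, hence the symmetry.
        ; invariant = λ α≈β → _∘ invariant S (≈-sym α≈β)
        }
        where S = settled χ d
      settled (E ψ)          d = Existential.E-settled (monitor ψ d)

      monitor : ∀ ψ → sizeᵖ ψ ℕ.∣ N → Monitor ψ
      monitor (state χ) d = state-monitor (settled χ d)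
      monitor (ψ ∧ᵖ ψ′) d = ∧-monitor (monitor ψ (ℕ.m*n∣⇒m∣ _ (sizeᵖ ψ′) d)) (monitor ψ′ (ℕ.m*n∣⇒n∣ (sizeᵖ ψ) _ d))
      monitor (¬ᵖ ψ)    d = ¬-monitor (monitor ψ d)
      monitor (X ψ)     d = X-monitor (monitor ψ d)
      monitor (G ψ)     d = G-monitor (monitor ψ d)
      monitor (ψ U ψ′)  d = U-monitor (monitor ψ (ℕ.m*n∣⇒m∣ _ (sizeᵖ ψ′) d)) (monitor ψ′ (ℕ.m*n∣⇒n∣ (sizeᵖ ψ) _ d))

    -- An invariant property is a union of equivalence classes, each of which meets the box; whether
    -- a class belongs to it is decided at a box assignment while the constraint is built.
    configuration-definable : ∀ {χ} → Settled χ → ∀ b → Definable (λ α → (b , α) ⊨ χ)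
    configuration-definable {χ} S b = definable-⇔
      (λ α → mk⇔ (λ (k , α≈k , p) → invariant S (≈-sym α≈k) p)
                 (λ p → let k , α≈k = representative α in k , α≈k , invariant S α≈k p))
      (definable-∃ λ k → definable-× (definable-≈ (decode k)) (definable-dec (decide S (b , decode k))))

  -- The common multiple and the final assembly

  guardSize : Action → ℕ
  guardSize a = product (map size (guard a))

  guardsSize : ℕ
  guardsSize = product (map guardSize (allFin #actions))

  guardsSize≢0 : NonZero guardsSize
  guardsSize≢0 = product≢0 (All.map⁺ (All.universal guardSize≢0 (allFin #actions)))
    where
    guardSize≢0 : ∀ a → NonZero (guardSize a)
    guardSize≢0 a = product≢0 (All.map⁺ (All.universal size≢0 (guard a)))

  size∣guardsSize : ∀ a → All (λ c → size c ℕ.∣ guardsSize) (guard a)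
  size∣guardsSize a = All.tabulate λ c∈ →
    ℕ.∣-trans (∈⇒∣product (∈-map⁺ size c∈)) (∈⇒∣product (∈-map⁺ guardSize (∈-allFin a)))

theorem4 : (𝓑 : IPC-DDSA) → let open IPC-DDSA 𝓑 in let open Semantics 𝓑 in
    (χ : IPCProperty) →
    Σ ConfigurationMap (λ K → ∀ (b : State) (α : Assignment Var) → ((b , α) ⊨ χ) ⇔ (α ⊨ᶜ K b))
    × Dec ((b-I , α-I) ⊨ χ)
theorem4 𝓑 χ = ((λ b → proj₁ (K b)) , (λ b → proj₂ (K b))) , Settled.decide S _
  where
  -- The first factor covers the guards, the second the formula.
  N = guardsSize 𝓑 ℕ.* sizeˢ χ
  instance
    N≢0 : NonZero N
    N≢0 = ℕ.m*n≢0 _ _ {{guardsSize≢0 𝓑}} {{sizeˢ≢0 χ}}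
  guards∣N = λ a → All.map (ℕ.∣m⇒∣m*n (sizeˢ χ)) (size∣guardsSize 𝓑 a)
  S = settled 𝓑 N guards∣N χ (ℕ.n∣m*n (guardsSize 𝓑))
  K = configuration-definable 𝓑 N guards∣N S
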